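{- Let $F$ be a field of characteristic different from $2$, let $a_1,a_2\in F^\times$ be such that $E=F(\sqrt{a_1},\sqrt{a_2})$ is Galois over $F$ with $G=\mathrm{Gal}(E/F)\cong\mathbb Z/2\mathbb Z\times\mathbb Z/2\mathbb Z$, and let $\sigma_1,\sigma_2\in G$ be the generators with $\sigma_1(\sqrt{a_1})=\sqrt{a_1}$, $\sigma_1(\sqrt{a_2})=-\sqrt{a_2}$, $\sigma_2(\sqrt{a_2})=\sqrt{a_2}$, $\sigma_2(\sqrt{a_1})=-\sqrt{a_1}$. Let $E_1=F(\sqrt{a_1})$, $E_2=F(\sqrt{a_2})$, $E_3=F(\sqrt{a_1a_2})$. Then the following five subsets of $E^\times$ are equal: \begin{align*} K_1&=\ker(1-\sigma_1)(1-\sigma_2)=\{e\in E^\times: e\,\sigma_1\sigma_2(e)=\sigma_1(e)\,\sigma_2(e)\},\\ K_2&=\ker(1-\sigma_1)\cdot\ker(1-\sigma_2),\\ K_3&=\langle E_1^\times,E_2^\times\rangle,\\ K_4&=\{e\in E^\times: N_{E/E_3}(e)\in F^\times\},\\ K_5&=\{e\in E^\times: N_{E/E_3}(e)\in N_{E_1/F}(E_1^\times)\cdot N_{E_2/F}(E_2^\times)\}. \end{align*}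
   Context: $\ker(1-\sigma_i)=\{e\in E^\times: e/\sigma_i(e)=1\}$. For subsets $A,B$ of a multiplicative group, $A\cdot B=\{ab:a\in A,b\in B\}$. $\langle E_1^\times,E_2^\times\rangle$ is the smallest subgroup of $E^\times$ containing $E_1^\times$ and $E_2^\times$. $N_{E/E_3}(e)=e\,\sigma_1\sigma_2(e)$ (note $\mathrm{Gal}(E/E_3)=\{\mathrm{id},\sigma_1\sigma_2\}$), and for $x\in E_i^\times$, $N_{E_i/F}(x)=x\,\bar x$ where $\bar x$ is the conjugate of $x$ over $F$ (i.e. $N_{E_i/F}(f+g\sqrt{a_i})=f^2-a_ig^2$). -}

module Defs where

open import Algebra.Apartness.Bundles using (HeytingField; HeytingCommutativeRing)
open import Algebra.Bundles using (CommutativeRing; Group; AbelianGroup; RawRing)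
import Algebra.Apartness.Properties.HeytingCommutativeRing as HeytingProperties
import Algebra.Construct.DirectProduct as DirectProduct
import Algebra.Morphism.Construct.Composition as Composition
import Algebra.Morphism.Construct.Identity as Identity
open import Algebra.Morphism.Bundles using (RingHomomorphism)
open import Algebra.Morphism.Structures using (module GroupMorphisms; module RingMorphisms)
import Data.Parity.Properties as Parity
open import Data.Product.Base using (Σ-syntax; ∃-syntax; _×_; _,_; proj₁; proj₂)
open import Function.Base using (_∘_)
open import Level using (Level; _⊔_; 0ℓ)
open import Relation.Unary using (Pred; _∈_; _∪_; ｛_｝)
import Relation.Binary.Reasoning.Setoid as SetoidReasoning

private
  variable
    a b c ℓ ℓ₁ ℓ₂ c′ ℓ₁′ ℓ₂′ : Level

_≅_ : Group a ℓ₁ → Group b ℓ₂ → Set (a ⊔ b ⊔ ℓ₁ ⊔ ℓ₂)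
G ≅ H = ∃[ φ ] GroupMorphisms.IsGroupIsomorphism (Group.rawGroup G) (Group.rawGroup H) φ

ℤ/2×ℤ/2 : Group 0ℓ 0ℓ
ℤ/2×ℤ/2 = DirectProduct.group Parity.+-0-group Parity.+-0-group

module GroupSubsets (G : Group c ℓ) where

  open Group G

  infixl 7 _·_

  _·_ : Pred Carrier a → Pred Carrier b → Pred Carrier (c ⊔ ℓ ⊔ a ⊔ b)
  (A · B) x = ∃[ u ] ∃[ v ] u ∈ A × v ∈ B × x ≈ u ∙ v

  -- The smallest subgroup containing S.
  data ⟨_⟩ (S : Pred Carrier a) : Pred Carrier (c ⊔ ℓ ⊔ a) where
    gen  : ∀ {x} → x ∈ S → x ∈ ⟨ S ⟩
    unit : ε ∈ ⟨ S ⟩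
    mul  : ∀ {x y} → x ∈ ⟨ S ⟩ → y ∈ ⟨ S ⟩ → x ∙ y ∈ ⟨ S ⟩
    inv  : ∀ {x} → x ∈ ⟨ S ⟩ → x ⁻¹ ∈ ⟨ S ⟩
    resp : ∀ {x y} → x ≈ y → x ∈ ⟨ S ⟩ → y ∈ ⟨ S ⟩

-- Fields are Heyting fields: "x is nonzero" is read as x # 0#, which in a
-- Heyting field says precisely that x is invertible.  No decidability of
-- equality is assumed.

rawRing : HeytingField c ℓ₁ ℓ₂ → RawRing c ℓ₁
rawRing K = CommutativeRing.rawRing
  (HeytingCommutativeRing.commutativeRing (HeytingField.heytingCommutativeRing K))

module Units (K : HeytingField c ℓ₁ ℓ₂) where

  open HeytingField K
  open HeytingProperties heytingCommutativeRing
    using (1#0; x#0y#0→xy#0; x-0≈x; invertibleˡ⇒#)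

  rightInverse⇒#0 : ∀ {x y} → x * y ≈ 1# → x # 0#
  rightInverse⇒#0 {x} {y} xy≈1 =
    invertibleˡ⇒# (y , trans (*-congˡ (x-0≈x x)) (trans (*-comm y x) xy≈1))

  recip : ∀ {x} → x # 0# → Carrier
  recip x#0 = proj₁ (#⇒invertible x#0)

  recip-inverseʳ : ∀ {x} (x#0 : x # 0#) → x * recip x#0 ≈ 1#
  recip-inverseʳ {x} x#0 =
    trans (*-congʳ (sym (x-0≈x x))) (proj₂ (proj₂ (#⇒invertible x#0)))

  recip-inverseˡ : ∀ {x} (x#0 : x # 0#) → recip x#0 * x ≈ 1#
  recip-inverseˡ {x} x#0 = trans (*-comm _ x) (recip-inverseʳ x#0)

  recip-cong : ∀ {x y} (x#0 : x # 0#) (y#0 : y # 0#) → x ≈ y → recip x#0 ≈ recip y#0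
  recip-cong {x} {y} x#0 y#0 x≈y = begin
    recip x#0                    ≈⟨ *-identityʳ _ ⟨
    recip x#0 * 1#               ≈⟨ *-congˡ (recip-inverseʳ y#0) ⟨
    recip x#0 * (y * recip y#0)  ≈⟨ *-assoc _ _ _ ⟨
    recip x#0 * y * recip y#0    ≈⟨ *-congʳ (*-congˡ x≈y) ⟨
    recip x#0 * x * recip y#0    ≈⟨ *-congʳ (recip-inverseˡ x#0) ⟩
    1# * recip y#0               ≈⟨ *-identityˡ _ ⟩
    recip y#0                    ∎
    where open SetoidReasoning setoid

  -- The multiplicative group K^×.
  units : AbelianGroup (c ⊔ ℓ₂) ℓ₁
  units = record
    { Carrier = Σ[ x ∈ Carrier ] x # 0#
    ; _≈_     = λ u v → proj₁ u ≈ proj₁ v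
    ; _∙_     = λ (x , x#0) (y , y#0) → x * y , x#0y#0→xy#0 x#0 y#0
    ; ε       = 1# , 1#0
    ; _⁻¹     = λ (x , x#0) → recip x#0 , rightInverse⇒#0 (recip-inverseˡ x#0)
    ; isAbelianGroup = record
      { isGroup = record
        { isMonoid = record
          { isSemigroup = record
            { isMagma = record
              { isEquivalence = record { refl = refl ; sym = sym ; trans = trans }
              ; ∙-cong        = *-cong
              }
            ; assoc = λ u v w → *-assoc (proj₁ u) (proj₁ v) (proj₁ w)
            }
          ; identity = (λ u → *-identityˡ (proj₁ u)) , (λ u → *-identityʳ (proj₁ u))
          }
        ; inverse = (λ u → recip-inverseˡ (proj₂ u)) , (λ u → recip-inverseʳ (proj₂ u))
        ; ⁻¹-cong = λ {u} {v} → recip-cong (proj₂ u) (proj₂ v)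
        }
      ; comm = λ u v → *-comm (proj₁ u) (proj₁ v)
      }
    }

  open AbelianGroup units public using () renaming (Carrier to Unit)

module Extension
  (F : HeytingField c ℓ₁ ℓ₂) (E : HeytingField c′ ℓ₁′ ℓ₂′)
  (ι : RingHomomorphism (rawRing F) (rawRing E))
  where

  private
    module F = HeytingField F
    module E = HeytingField E
  open E using (_≈_; _#_; _+_; _*_; -_; 0#; 1#)
  open RingHomomorphism ι using (⟦_⟧)
  open RingMorphisms (rawRing E) (rawRing E) using (IsRingIsomorphism)

  -- F(S), the smallest subfield of E containing F and S.
  data Adjoin (S : Pred E.Carrier a) : Pred E.Carrier (a ⊔ c ⊔ c′ ⊔ ℓ₁′) where
    base : ∀ x → ⟦ x ⟧ ∈ Adjoin S
    gen  : ∀ {x} → x ∈ S → x ∈ Adjoin S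
    add  : ∀ {x y} → x ∈ Adjoin S → y ∈ Adjoin S → x + y ∈ Adjoin S
    neg  : ∀ {x} → x ∈ Adjoin S → - x ∈ Adjoin S
    mul  : ∀ {x y} → x ∈ Adjoin S → y ∈ Adjoin S → x * y ∈ Adjoin S
    inv  : ∀ {x y} → x * y ≈ 1# → x ∈ Adjoin S → y ∈ Adjoin S
    resp : ∀ {x y} → x ≈ y → x ∈ Adjoin S → y ∈ Adjoin S

  record Automorphism : Set (c ⊔ c′ ⊔ ℓ₁′) where
    field
      to                : E.Carrier → E.Carrier
      isRingIsomorphism : IsRingIsomorphism to
      fixesBase         : ∀ x → to ⟦ x ⟧ ≈ ⟦ x ⟧

    open IsRingIsomorphism isRingIsomorphism public

    from : E.Carrier → E.Carrier
    from y = proj₁ (surjective y)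

    to∘from : ∀ y → to (from y) ≈ y
    to∘from y = proj₂ (surjective y) E.refl

    from∘to : ∀ x → from (to x) ≈ x
    from∘to x = injective (to∘from (to x))

    to-#0 : ∀ {x} → x # 0# → to x # 0#
    to-#0 {x} x#0 = Units.rightInverse⇒#0 E
      (E.trans (E.sym (*-homo x _))
        (E.trans (⟦⟧-cong (Units.recip-inverseʳ E x#0)) 1#-homo))

  open Automorphism

  identity : Automorphism
  identity = record
    { to                = λ x → x
    ; isRingIsomorphism = Identity.isRingIsomorphism (rawRing E) E.refl
    ; fixesBase         = λ _ → E.refl
    }

  _∘ᴬ_ : Automorphism → Automorphism → Automorphism
  σ ∘ᴬ τ = record
    { to                = to σ ∘ to τ
    ; isRingIsomorphism =
        Composition.isRingIsomorphism E.trans (isRingIsomorphism τ) (isRingIsomorphism σ)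
    ; fixesBase         = λ x → E.trans (⟦⟧-cong σ (fixesBase τ x)) (fixesBase σ x)
    }

  inverse : Automorphism → Automorphism
  inverse σ = record
    { to                = from σ
    ; isRingIsomorphism = record
      { isRingMonomorphism = record
        { isRingHomomorphism = record
          { isSemiringHomomorphism = record
            { isNearSemiringHomomorphism = record
              { +-isMonoidHomomorphism = record
                { isMagmaHomomorphism = record
                  { isRelHomomorphism = record { cong = from-cong }
                  ; homo = λ x y → injective σ (E.trans (to∘from σ _) (E.sym
                      (E.trans (+-homo σ _ _) (E.+-cong (to∘from σ x) (to∘from σ y)))))
                  }
                ; ε-homo = injective σ (E.trans (to∘from σ _) (E.sym (0#-homo σ)))
                }
              ; *-homo = λ x y → injective σ (E.trans (to∘from σ _) (E.sym
                  (E.trans (*-homo σ _ _) (E.*-cong (to∘from σ x) (to∘from σ y)))))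
              }
            ; 1#-homo = injective σ (E.trans (to∘from σ _) (E.sym (1#-homo σ)))
            }
          ; -‿homo = λ x → injective σ (E.trans (to∘from σ _) (E.sym
              (E.trans (-‿homo σ _) (E.-‿cong (to∘from σ x)))))
          }
        ; injective = λ {x} {y} eq →
            E.trans (E.sym (to∘from σ x)) (E.trans (⟦⟧-cong σ eq) (to∘from σ y))
        }
      ; surjective = λ y → to σ y , λ eq → E.trans (from-cong eq) (from∘to σ y)
      }
    ; fixesBase = λ x → injective σ (E.trans (to∘from σ _) (E.sym (fixesBase σ x)))
    }
    where
    from-cong : ∀ {x y} → x ≈ y → from σ x ≈ from σ y
    from-cong {x} {y} x≈y =
      injective σ (E.trans (to∘from σ x) (E.trans x≈y (E.sym (to∘from σ y))))

  -- Gal(E/F) = Aut(E/F).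
  Gal : Group (c ⊔ c′ ⊔ ℓ₁′) (c′ ⊔ ℓ₁′)
  Gal = record
    { Carrier = Automorphism
    ; _≈_     = λ σ τ → ∀ x → to σ x ≈ to τ x
    ; _∙_     = _∘ᴬ_
    ; ε       = identity
    ; _⁻¹     = inverse
    ; isGroup = record
      { isMonoid = record
        { isSemigroup = record
          { isMagma = record
            { isEquivalence = record
              { refl  = λ _ → E.refl
              ; sym   = λ p x → E.sym (p x)
              ; trans = λ p q x → E.trans (p x) (q x)
              }
            ; ∙-cong = λ {σ} {σ′} {τ} {τ′} p q x →
                E.trans (⟦⟧-cong σ (q x)) (p (to τ′ x))
            }
          ; assoc = λ _ _ _ _ → E.refl
          }
        ; identity = (λ _ _ → E.refl) , (λ _ _ → E.refl)
        }
      ; inverse = from∘to , to∘from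
      ; ⁻¹-cong = λ {σ} {τ} p x → injective σ
          (E.trans (to∘from σ x) (E.sym (E.trans (p (from τ x)) (to∘from τ x))))
      }
    }

  -- E/F is Galois: the fixed field of Aut(E/F) is F.  The usual requirement
  -- that E/F be algebraic is left to the context; it is automatic for
  -- extensions generated by finitely many square roots.
  IsGalois : Set (c ⊔ c′ ⊔ ℓ₁′)
  IsGalois = ∀ x → (∀ (σ : Automorphism) → to σ x ≈ x) → ∃[ y ] ⟦ y ⟧ ≈ x

  F^× : Set (c ⊔ ℓ₂)
  F^× = Units.Unit F

  E^× : Set (c′ ⊔ ℓ₂′)
  E^× = Units.Unit E

  private
    module E^× = Group (AbelianGroup.group (Units.units E))
  open GroupSubsets (AbelianGroup.group (Units.units E))

  infixr 8 _•_

  _•_ : Automorphism → E^× → E^×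
  σ • (x , x#0) = to σ x , to-#0 σ x#0

  -- F^× as a subset of E^×.
  Base^× : Pred E^× (c ⊔ ℓ₂ ⊔ ℓ₁′)
  Base^× e = Σ[ f ∈ F^× ] ⟦ proj₁ f ⟧ ≈ proj₁ e

  _ˣ : Pred E.Carrier a → Pred E^× a
  (L ˣ) e = proj₁ e ∈ L

  -- ker(1-σ) on E^×, with e/σ(e) formed in the group E^×.
  ker[1-_] : Automorphism → Pred E^× ℓ₁′
  ker[1- σ ] e = e E^×.// (σ • e) E^×.≈ E^×.ε

  -- x and x̄ are conjugate in F(s), where s² ∈ F: x = f + gs and x̄ = f - gs.
  Conjugate : E.Carrier → E.Carrier → E.Carrier → Set (c ⊔ ℓ₁′)
  Conjugate s x x̄ = ∃[ f ] ∃[ g ]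
    x ≈ ⟦ f ⟧ + ⟦ g ⟧ * s × x̄ ≈ ⟦ f ⟧ + - (⟦ g ⟧ * s)

  -- The subset N_{F(s)/F}(F(s)^×) of E^×, where s² ∈ F and N(x) = x x̄.
  NormGroup : E.Carrier → Pred E^× (c ⊔ c′ ⊔ ℓ₁′ ⊔ ℓ₂′)
  NormGroup s n = Σ[ x ∈ E^× ] Σ[ x̄ ∈ E.Carrier ]
    x ∈ (Adjoin ｛ s ｝ ˣ) × Conjugate s (proj₁ x) x̄ × proj₁ n ≈ proj₁ x * x̄

  module Subsets (√a₁ √a₂ : E.Carrier) (σ₁ σ₂ : Automorphism) where

    E₁ E₂ E₃ : Pred E.Carrier (c ⊔ c′ ⊔ ℓ₁′)
    E₁ = Adjoin ｛ √a₁ ｝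
    E₂ = Adjoin ｛ √a₂ ｝
    E₃ = Adjoin ｛ √a₁ * √a₂ ｝

    -- Gal(E/E₃) = {id, σ₁σ₂}, hence N_{E/E₃}(e) = e · σ₁σ₂(e).
    N[E/E₃] : E^× → E^×
    N[E/E₃] e = e E^×.∙ ((σ₁ ∘ᴬ σ₂) • e)

    K₁ : Pred E^× ℓ₁′
    K₁ e = e E^×.∙ ((σ₁ ∘ᴬ σ₂) • e) E^×.≈ (σ₁ • e) E^×.∙ (σ₂ • e)

    K₂ : Pred E^× (c′ ⊔ ℓ₁′ ⊔ ℓ₂′)
    K₂ = ker[1- σ₁ ] · ker[1- σ₂ ]

    K₃ : Pred E^× (c ⊔ c′ ⊔ ℓ₁′ ⊔ ℓ₂′)
    K₃ = ⟨ (E₁ ˣ) ∪ (E₂ ˣ) ⟩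

    K₄ : Pred E^× (c ⊔ ℓ₂ ⊔ ℓ₁′)
    K₄ e = N[E/E₃] e ∈ Base^×

    K₅ : Pred E^× (c ⊔ c′ ⊔ ℓ₁′ ⊔ ℓ₂′)
    K₅ e = N[E/E₃] e ∈ NormGroup √a₁ · NormGroup √a₂

{-# OPTIONS --safe #-}

-- Everything is reduced to K₁.  Elements fixed by σ₁ and σ₂ are fixed by the
-- whole Galois group, hence lie in F; splitting x into (x ± ρ x)/2 then
-- identifies Eᵢ with the fixed field of σᵢ.  The essential step is K₁ ⊆ K₂: for
-- e in K₁ the quotient w = e/σ₁(e) lies in E₂ and w σ₁(w) = 1, so Hilbert 90
-- gives w = y/σ₁(y) with y in E₂^×, and e = (e/y) y.  For e = u v with u in E₁
-- and v in E₂, N_{E/E₃}(e) = N_{E₁/F}(u) N_{E₂/F}(v).  Conversely, the equation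
-- defining K₁ says that σ₁ fixes N_{E/E₃}(e).
module Submission where

open import Algebra.Apartness.Bundles using (HeytingField; HeytingCommutativeRing)
import Algebra.Apartness.Properties.HeytingCommutativeRing as HeytingProperties
open import Algebra.Bundles using (AbelianGroup; CommutativeRing)
open import Algebra.Morphism.Bundles using (RingHomomorphism)
import Algebra.Properties.CommutativeSemigroup as CommutativeSemigroupProperties
import Algebra.Properties.Group as GroupProperties
import Algebra.Properties.Ring as RingProperties
open import Data.Product.Base using (_×_; _,_; proj₁; proj₂; ∃-syntax)
open import Data.Sum.Base using (_⊎_; inj₁; inj₂)
open import Function.Base using (case_of_)
open import Level using (Level; _⊔_)
import Relation.Binary.PropositionalEquality.Core as ≡
import Relation.Binary.Reasoning.Setoid as SetoidReasoning
open import Relation.Unary using (Pred; _∈_; _∪_; _≐_; ｛_｝)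
open import Defs

private
  variable
    a c ℓ₁ ℓ₂ c′ ℓ₁′ ℓ₂′ : Level

-- Arithmetic in a Heyting field.

module FieldProperties (K : HeytingField c ℓ₁ ℓ₂) where

  open HeytingField K
  open HeytingProperties heytingCommutativeRing using (#-congʳ)
  open Units K using (rightInverse⇒#0; recip; recip-inverseˡ)
  private
    commutativeRing = HeytingCommutativeRing.commutativeRing heytingCommutativeRing
    module R = CommutativeRing commutativeRing
    module +-group = GroupProperties (AbelianGroup.group R.+-abelianGroup)
  open RingProperties R.ring using (-‿distribˡ-*; -‿distribʳ-*; -‿involutive)
  module * = CommutativeSemigroupProperties R.*-commutativeSemigroup
  module + = CommutativeSemigroupProperties R.+-commutativeSemigroup
  open SetoidReasoning setoid

  *-cancelˡ : ∀ {x y z} → x # 0# → x * y ≈ x * z → y ≈ z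
  *-cancelˡ {x} {y} {z} x#0 eq = begin
    y                   ≈⟨ *-identityˡ y ⟨
    1# * y              ≈⟨ *-congʳ (recip-inverseˡ x#0) ⟨
    recip x#0 * x * y   ≈⟨ *-assoc _ _ _ ⟩
    recip x#0 * (x * y) ≈⟨ *-congˡ eq ⟩
    recip x#0 * (x * z) ≈⟨ *-assoc _ _ _ ⟨
    recip x#0 * x * z   ≈⟨ *-congʳ (recip-inverseˡ x#0) ⟩
    1# * z              ≈⟨ *-identityˡ z ⟩
    z                   ∎

  inverse-unique : ∀ {x y z} → x * y ≈ 1# → x * z ≈ 1# → y ≈ z
  inverse-unique xy≈1 xz≈1 =
    *-cancelˡ (rightInverse⇒#0 xy≈1) (trans xy≈1 (sym xz≈1))

  -- Cross-multiplication: insert `q * q′`, exchange factors, remove `n * n′`. The inverses are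
  -- arbitrary witnesses instead of values of `recip`, so that the image of an inverse under an
  -- automorphism can serve as one.
  fraction-≈ : ∀ {m n p q n′ q′} → n * n′ ≈ 1# → q * q′ ≈ 1# →
               m * q ≈ p * n → m * n′ ≈ p * q′
  fraction-≈ {m} {n} {p} {q} {n′} {q′} nn′≈1 qq′≈1 mq≈pn = begin
    m * n′              ≈⟨ *-identityʳ _ ⟨
    m * n′ * 1#         ≈⟨ *-congˡ qq′≈1 ⟨
    m * n′ * (q * q′)   ≈⟨ *.interchange m n′ q q′ ⟩
    m * q * (n′ * q′)   ≈⟨ *-congʳ mq≈pn ⟩
    p * n * (n′ * q′)   ≈⟨ *-congˡ (*-comm n′ q′) ⟩
    p * n * (q′ * n′)   ≈⟨ *.interchange p n q′ n′ ⟩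
    p * q′ * (n * n′)   ≈⟨ *-congˡ nn′≈1 ⟩
    p * q′ * 1#         ≈⟨ *-identityʳ _ ⟩
    p * q′              ∎

  [x+y]+[x-y]≈x+x : ∀ x y → (x + y) + (x - y) ≈ x + x
  [x+y]+[x-y]≈x+x x y = begin
    (x + y) + (x - y)   ≈⟨ +.interchange x y x (- y) ⟩
    (x + x) + (y - y)   ≈⟨ +-congˡ (-‿inverseʳ y) ⟩
    (x + x) + 0#        ≈⟨ +-identityʳ _ ⟩
    x + x               ∎

  [x+y]-x≈y : ∀ x y → (x + y) - x ≈ y
  [x+y]-x≈y x y = begin
    (x + y) - x   ≈⟨ +-congʳ (+-comm x y) ⟩
    (y + x) - x   ≈⟨ +-assoc y x (- x) ⟩
    y + (x - x)   ≈⟨ +-congˡ (-‿inverseʳ x) ⟩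
    y + 0#        ≈⟨ +-identityʳ y ⟩
    y             ∎

  -- Cotransitivity compares `x` with both ends of `x + y # 0#`; if `x + y # x`, then the difference
  -- `y` is invertible. This stands in for deciding whether an element is zero.
  x+y#0⇒x#0⊎y#0 : ∀ {x y} → x + y # 0# → x # 0# ⊎ y # 0#
  x+y#0⇒x#0⊎y#0 {x} {y} x+y#0 with #-cotrans x+y#0 x
  ... | inj₂ x#0   = inj₁ x#0
  ... | inj₁ x+y#x = let z , _ , inv = #⇒invertible x+y#x in
    inj₂ (rightInverse⇒#0 (trans (*-congʳ (sym ([x+y]-x≈y x y))) inv))

  x+x#0⇒x+y#0⊎x-y#0 : ∀ {x} y → x + x # 0# → x + y # 0# ⊎ x - y # 0#
  x+x#0⇒x+y#0⊎x-y#0 {x} y x+x#0 =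
    x+y#0⇒x#0⊎y#0 (#-congʳ (sym ([x+y]+[x-y]≈x+x x y)) x+x#0)

  -x*-y≈x*y : ∀ x y → - x * - y ≈ x * y
  -x*-y≈x*y x y = begin
    - x * - y     ≈⟨ -‿distribˡ-* x (- y) ⟨
    - (x * - y)   ≈⟨ -‿cong (-‿distribʳ-* x y) ⟨
    - - (x * y)   ≈⟨ -‿involutive _ ⟩
    x * y         ∎

  -[x-y]≈y-x : ∀ x y → - (x - y) ≈ y - x
  -[x-y]≈y-x = +-group.⁻¹-anti-homo-//

  [x+y][x-y]≈x²-y² : ∀ x y → (x + y) * (x - y) ≈ x * x - y * y
  [x+y][x-y]≈x²-y² x y = begin
    (x + y) * (x - y)                   ≈⟨ distribˡ (x + y) x (- y) ⟩
    (x + y) * x + (x + y) * - y         ≈⟨ +-cong (distribʳ x x y) (distribʳ (- y) x y) ⟩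
    (x * x + y * x) + (x * - y + y * - y) ≈⟨ +-cong (+-congˡ (*-comm x y)) (+-cong (-‿distribʳ-* x y) (-‿distribʳ-* y y)) ⟨
    (x * x + x * y) + (- (x * y) - y * y) ≈⟨ +-assoc _ _ _ ⟩
    x * x + (x * y + (- (x * y) - y * y)) ≈⟨ +-congˡ (+-assoc _ _ _) ⟨
    x * x + ((x * y - x * y) - y * y)     ≈⟨ +-congˡ (+-congʳ (-‿inverseʳ _)) ⟩
    x * x + (0# - y * y)                  ≈⟨ +-congˡ (+-identityˡ _) ⟩
    x * x - y * y                       ∎

  -- The product of `x + y` and `x - y` vanishes, while their sum `x + x` is nonzero. Hence one
  -- factor is invertible and can be cancelled, which makes the other one zero.
  square-roots : ∀ {x y} → x + x # 0# → y * y ≈ x * x → y ≈ x ⊎ y ≈ - x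
  square-roots {x} {y} x+x#0 y²≈x² = case x+x#0⇒x+y#0⊎x-y#0 y x+x#0 of λ where
      (inj₁ x+y#0) → inj₁ (sym (+-group.x∙y⁻¹≈ε⇒x≈y x y (*-cancelˡ x+y#0
                       (trans product≈0 (sym (zeroʳ _))))))
      (inj₂ x-y#0) → inj₂ (+-group.inverseʳ-unique x y (*-cancelˡ x-y#0
                       (trans (*-comm _ _) (trans product≈0 (sym (zeroʳ _))))))
    where
    product≈0 : (x + y) * (x - y) ≈ 0#
    product≈0 = begin
      (x + y) * (x - y)   ≈⟨ [x+y][x-y]≈x²-y² x y ⟩
      x * x - y * y       ≈⟨ +-congˡ (-‿cong y²≈x²) ⟩
      x * x - x * x       ≈⟨ -‿inverseʳ _ ⟩
      0#                  ∎

-- Automorphisms, fixed elements and Hilbert 90.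

module AutomorphismProperties
  (F : HeytingField c ℓ₁ ℓ₂) (E : HeytingField c′ ℓ₁′ ℓ₂′)
  (ι : RingHomomorphism (rawRing F) (rawRing E))
  where

  private
    module F = HeytingField F
  open HeytingField E
  open RingHomomorphism ι using (⟦_⟧; ⟦⟧-cong; +-homo; *-homo; 1#-homo; -‿homo)
  open Extension F E ι
  open Automorphism using (to)
  open Units E using (rightInverse⇒#0)
  open FieldProperties E
  open HeytingProperties heytingCommutativeRing using (1#0; x#0y#0→xy#0)
  open RingProperties
    (CommutativeRing.ring (HeytingCommutativeRing.commutativeRing heytingCommutativeRing))
    using (-‿distribʳ-*; -‿involutive; x[y-z]≈xy-xz)
  private
    module A = Automorphism
    module E^× = AbelianGroup (Units.units E)
  open SetoidReasoning setoid

  -- By tightness it is enough to refute `x * y # 1` in `F`. In that case `x * y - 1` would be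
  -- invertible, and so would its image in `E`; but that image is zero.
  ⟦⟧-reflects-inverse : ∀ {x y} → ⟦ x ⟧ * ⟦ y ⟧ ≈ 1# → x F.* y F.≈ F.1#
  ⟦⟧-reflects-inverse {x} {y} eq =
    proj₁ (F.tight (x F.* y) F.1#) λ xy#1 →
      let z , _ , dz≈1 = F.#⇒invertible xy#1
      in proj₂ (tight 1# 0#) (begin
        1#                                  ≈⟨ 1#-homo ⟨
        ⟦ F.1# ⟧                            ≈⟨ ⟦⟧-cong dz≈1 ⟨
        ⟦ (x F.* y F.- F.1#) F.* z ⟧        ≈⟨ *-homo _ _ ⟩
        ⟦ x F.* y F.- F.1# ⟧ * ⟦ z ⟧        ≈⟨ *-congʳ (+-homo _ _) ⟩
        (⟦ x F.* y ⟧ + ⟦ F.- F.1# ⟧) * ⟦ z ⟧ ≈⟨ *-congʳ (+-cong (trans (*-homo x y) eq)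
                                               (trans (-‿homo _) (-‿cong 1#-homo))) ⟩
        (1# - 1#) * ⟦ z ⟧                   ≈⟨ *-congʳ (-‿inverseʳ 1#) ⟩
        0# * ⟦ z ⟧                          ≈⟨ zeroˡ _ ⟩
        0#                                  ∎) 1#0

  ⟦⟧-inverse : ∀ {x y} → x F.* y F.≈ F.1# → ⟦ x ⟧ * ⟦ y ⟧ ≈ 1#
  ⟦⟧-inverse xy≈1 = trans (sym (*-homo _ _)) (trans (⟦⟧-cong xy≈1) 1#-homo)

  Fixed : Automorphism → Pred Carrier ℓ₁′
  Fixed σ x = to σ x ≈ x

  module _ (σ : Automorphism) where

    fixed-* : ∀ {x y} → Fixed σ x → Fixed σ y → Fixed σ (x * y)
    fixed-* p q = trans (A.*-homo σ _ _) (*-cong p q)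

    fixed-+ : ∀ {x y} → Fixed σ x → Fixed σ y → Fixed σ (x + y)
    fixed-+ p q = trans (A.+-homo σ _ _) (+-cong p q)

    fixed-neg : ∀ {x} → Fixed σ x → Fixed σ (- x)
    fixed-neg p = trans (A.-‿homo σ _) (-‿cong p)

    fixed-resp : ∀ {x y} → x ≈ y → Fixed σ x → Fixed σ y
    fixed-resp x≈y p = trans (A.⟦⟧-cong σ (sym x≈y)) (trans p x≈y)

    to-inverse : ∀ {x y} → x * y ≈ 1# → to σ x * to σ y ≈ 1#
    to-inverse xy≈1 =
      trans (sym (A.*-homo σ _ _)) (trans (A.⟦⟧-cong σ xy≈1) (A.1#-homo σ))

    fixed-inverse : ∀ {x y} → x * y ≈ 1# → Fixed σ x → Fixed σ y
    fixed-inverse xy≈1 p =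
      inverse-unique (trans (*-congʳ (sym p)) (to-inverse xy≈1)) xy≈1

    fixed⇒ker : ∀ {e} → Fixed σ (proj₁ e) → e ∈ ker[1- σ ]
    fixed⇒ker {e} p = x≈y⇒x∙y⁻¹≈ε {e} {σ • e} (sym p)
      where open GroupProperties E^×.group

    ker⇒fixed : ∀ {e} → e ∈ ker[1- σ ] → Fixed σ (proj₁ e)
    ker⇒fixed {e} p = sym (x∙y⁻¹≈ε⇒x≈y e (σ • e) p)
      where open GroupProperties E^×.group

  -- The elements on which two automorphisms agree form a subfield containing `F`. Taking `τ` to be
  -- the identity gives fixed elements; two general automorphisms give uniqueness from values on
  -- generators.
  agree-on-Adjoin : ∀ {S : Pred Carrier a} (σ τ : Automorphism) →
                    (∀ {x} → x ∈ S → to σ x ≈ to τ x) →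
                    ∀ {x} → x ∈ Adjoin S → to σ x ≈ to τ x
  agree-on-Adjoin {S = S} σ τ onS = go
    where
    go : ∀ {x} → x ∈ Adjoin S → to σ x ≈ to τ x
    go (base x)  = trans (A.fixesBase σ x) (sym (A.fixesBase τ x))
    go (gen x∈S) = onS x∈S
    go (add p q) =
      trans (A.+-homo σ _ _) (trans (+-cong (go p) (go q)) (sym (A.+-homo τ _ _)))
    go (neg p)   = trans (A.-‿homo σ _) (trans (-‿cong (go p)) (sym (A.-‿homo τ _)))
    go (mul p q) =
      trans (A.*-homo σ _ _) (trans (*-cong (go p) (go q)) (sym (A.*-homo τ _ _)))
    -- Both `σ y` and `τ y` are inverse to `τ x`.
    go (inv xy≈1 p) =
      inverse-unique (trans (*-congʳ (sym (go p))) (to-inverse σ xy≈1)) (to-inverse τ xy≈1)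
    go (resp x≈y p) =
      trans (A.⟦⟧-cong σ (sym x≈y)) (trans (go p) (A.⟦⟧-cong τ x≈y))

  Adjoin-fixed : ∀ σ {s} → Fixed σ s → ∀ {x} → x ∈ Adjoin ｛ s ｝ → Fixed σ x
  Adjoin-fixed σ σs≈s = agree-on-Adjoin σ identity λ where ≡.refl → σs≈s

  -- The candidates c + w σ(c) for c = 1 and c = t are 1 + w and t (1 - w), and
  -- 1 + w and 1 - w do not both vanish.
  hilbert90 : ∀ (σ : Automorphism) {t w} → 1# + 1# # 0# → t # 0# → to σ t ≈ - t →
              w * to σ w ≈ 1# →
              ∃[ y ] y # 0# × w * to σ y ≈ y ×
                (∀ ρ → Fixed ρ t → Fixed ρ w → Fixed ρ y)
  hilbert90 σ {t} {w} 2#0 t#0 σt≈-t wσw≈1 with x+x#0⇒x+y#0⊎x-y#0 w 2#0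
  ... | inj₁ 1+w#0 = 1# + w , 1+w#0 , eq , λ ρ _ ρw → fixed-+ ρ (A.1#-homo ρ) ρw
    where
    eq : w * to σ (1# + w) ≈ 1# + w
    eq = begin
      w * to σ (1# + w)       ≈⟨ *-congˡ (trans (A.+-homo σ _ _) (+-congʳ (A.1#-homo σ))) ⟩
      w * (1# + to σ w)       ≈⟨ distribˡ w 1# (to σ w) ⟩
      w * 1# + w * to σ w     ≈⟨ +-cong (*-identityʳ w) wσw≈1 ⟩
      w + 1#                  ≈⟨ +-comm w 1# ⟩
      1# + w                  ∎
  ... | inj₂ 1-w#0 = t * (1# - w) , x#0y#0→xy#0 t#0 1-w#0 , eq ,
      λ ρ ρt ρw → fixed-* ρ ρt (fixed-+ ρ (A.1#-homo ρ) (fixed-neg ρ ρw))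
    where
    eq : w * to σ (t * (1# - w)) ≈ t * (1# - w)
    eq = begin
      w * to σ (t * (1# - w))      ≈⟨ *-congˡ (trans (A.*-homo σ _ _) (*-cong σt≈-t
                                        (trans (A.+-homo σ _ _) (+-cong (A.1#-homo σ) (A.-‿homo σ _))))) ⟩
      w * (- t * (1# - to σ w))    ≈⟨ *.x∙yz≈y∙xz w (- t) _ ⟩
      - t * (w * (1# - to σ w))    ≈⟨ *-congˡ (x[y-z]≈xy-xz w 1# (to σ w)) ⟩
      - t * (w * 1# - w * to σ w)  ≈⟨ *-congˡ (+-cong (*-identityʳ w) (-‿cong wσw≈1)) ⟩
      - t * (w - 1#)               ≈⟨ *-congˡ (-[x-y]≈y-x 1# w) ⟨
      - t * - (1# - w)             ≈⟨ -x*-y≈x*y t (1# - w) ⟩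
      t * (1# - w)                 ∎

  -- The fixed field of one involution as a quadratic extension of `F`.

  record QuadraticSplitting (s : Carrier) (σ ρ : Automorphism) : Set (c ⊔ c′ ⊔ ℓ₁′) where
    field
      -- These inverses are taken in `F`, because the coefficients of an expansion `f + g s` must be
      -- elements of `F`.
      half s⁻²  : F.Carrier
      2*half≈1  : (1# + 1#) * ⟦ half ⟧ ≈ 1#
      s²*s⁻²≈1  : s * s * ⟦ s⁻² ⟧ ≈ 1#
      σs≈s      : Fixed σ s
      ρs≈-s     : to ρ s ≈ - s
      involutive : ∀ x → to ρ (to ρ x) ≈ x
      commute   : ∀ x → to σ (to ρ x) ≈ to ρ (to σ x)
      descent   : ∀ {x} → Fixed σ x → Fixed ρ x → ∃[ f ] ⟦ f ⟧ ≈ x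

    halve : ∀ x → (x + x) * ⟦ half ⟧ ≈ x
    halve x = begin
      (x + x) * ⟦ half ⟧             ≈⟨ *-congʳ (+-cong (*-identityʳ x) (*-identityʳ x)) ⟨
      (x * 1# + x * 1#) * ⟦ half ⟧   ≈⟨ *-congʳ (distribˡ x 1# 1#) ⟨
      x * (1# + 1#) * ⟦ half ⟧       ≈⟨ *-assoc _ _ _ ⟩
      x * ((1# + 1#) * ⟦ half ⟧)     ≈⟨ *-congˡ 2*half≈1 ⟩
      x * 1#                         ≈⟨ *-identityʳ x ⟩
      x                              ∎

    -- x = f + g s with f = (x + ρ x)/2 and g = (x - ρ x) s/(2s²).
    fixed⇒conjugate : ∀ {x} → Fixed σ x → Conjugate s x (to ρ x)
    fixed⇒conjugate {x} σx≈x = f , g , x≈f+gs , ρx≈f-gs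
      where
      y = to ρ x

      σy≈y : Fixed σ y
      σy≈y = trans (commute x) (A.⟦⟧-cong ρ σx≈x)

      ρf₀ : Fixed ρ (x + y)
      ρf₀ = trans (A.+-homo ρ x y) (trans (+-congˡ (involutive x)) (+-comm y x))

      -- Both factors change sign under `ρ`, so the product is fixed and descends to `F`.
      ρg₀ : Fixed ρ ((x - y) * s)
      ρg₀ = begin
        to ρ ((x - y) * s)    ≈⟨ A.*-homo ρ _ _ ⟩
        to ρ (x - y) * to ρ s ≈⟨ *-cong (trans (A.+-homo ρ _ _) (+-congˡ
                                   (trans (A.-‿homo ρ y) (-‿cong (involutive x))))) ρs≈-s ⟩
        (y - x) * - s         ≈⟨ *-congʳ (-[x-y]≈y-x x y) ⟨
        - (x - y) * - s       ≈⟨ -x*-y≈x*y (x - y) s ⟩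
        (x - y) * s           ∎

      f₀-descends : ∃[ f ] ⟦ f ⟧ ≈ x + y
      f₀-descends = descent (fixed-+ σ σx≈x σy≈y) ρf₀

      g₀-descends : ∃[ g ] ⟦ g ⟧ ≈ (x - y) * s
      g₀-descends = descent (fixed-* σ (fixed-+ σ σx≈x (fixed-neg σ σy≈y)) σs≈s) ρg₀

      f = proj₁ f₀-descends F.* half
      g = proj₁ g₀-descends F.* (s⁻² F.* half)

      f≈ : ⟦ f ⟧ ≈ (x + y) * ⟦ half ⟧
      f≈ = trans (*-homo _ _) (*-congʳ (proj₂ f₀-descends))

      gs≈ : ⟦ g ⟧ * s ≈ (x - y) * ⟦ half ⟧
      gs≈ = begin
        ⟦ g ⟧ * s                                    ≈⟨ *-congʳ (trans (*-homo _ _) (*-cong (proj₂ g₀-descends) (*-homo _ _))) ⟩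
        (x - y) * s * (⟦ s⁻² ⟧ * ⟦ half ⟧) * s       ≈⟨ *.xy∙z≈xz∙y _ _ s ⟩
        (x - y) * s * s * (⟦ s⁻² ⟧ * ⟦ half ⟧)       ≈⟨ *-congʳ (*-assoc _ s s) ⟩
        (x - y) * (s * s) * (⟦ s⁻² ⟧ * ⟦ half ⟧)     ≈⟨ *-assoc _ _ _ ⟩
        (x - y) * (s * s * (⟦ s⁻² ⟧ * ⟦ half ⟧))     ≈⟨ *-congˡ (*-assoc _ _ _) ⟨
        (x - y) * (s * s * ⟦ s⁻² ⟧ * ⟦ half ⟧)       ≈⟨ *-congˡ (*-congʳ s²*s⁻²≈1) ⟩
        (x - y) * (1# * ⟦ half ⟧)                    ≈⟨ *-congˡ (*-identityˡ _) ⟩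
        (x - y) * ⟦ half ⟧                           ∎

      x≈f+gs : x ≈ ⟦ f ⟧ + ⟦ g ⟧ * s
      x≈f+gs = begin
        x                                            ≈⟨ halve x ⟨
        (x + x) * ⟦ half ⟧                           ≈⟨ *-congʳ ([x+y]+[x-y]≈x+x x y) ⟨
        ((x + y) + (x - y)) * ⟦ half ⟧               ≈⟨ distribʳ _ _ _ ⟩
        (x + y) * ⟦ half ⟧ + (x - y) * ⟦ half ⟧      ≈⟨ +-cong f≈ gs≈ ⟨
        ⟦ f ⟧ + ⟦ g ⟧ * s                            ∎

      ρx≈f-gs : y ≈ ⟦ f ⟧ - ⟦ g ⟧ * s
      ρx≈f-gs = begin
        to ρ x                          ≈⟨ A.⟦⟧-cong ρ x≈f+gs ⟩
        to ρ (⟦ f ⟧ + ⟦ g ⟧ * s)        ≈⟨ trans (A.+-homo ρ _ _) (+-congˡ (A.*-homo ρ _ _)) ⟩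
        to ρ ⟦ f ⟧ + to ρ ⟦ g ⟧ * to ρ s ≈⟨ +-cong (A.fixesBase ρ f) (*-cong (A.fixesBase ρ g) ρs≈-s) ⟩
        ⟦ f ⟧ + ⟦ g ⟧ * - s             ≈⟨ +-congˡ (-‿distribʳ-* _ _) ⟨
        ⟦ f ⟧ - ⟦ g ⟧ * s               ∎

    fixed⇒Adjoin : ∀ {x} → Fixed σ x → x ∈ Adjoin ｛ s ｝
    fixed⇒Adjoin σx≈x = let f , g , x≈f+gs , _ = fixed⇒conjugate σx≈x in
      resp (sym x≈f+gs) (add (base f) (mul (base g) (gen ≡.refl)))

    -- On the fixed field of `σ`, the map `ρ` is the conjugation sending `s` to `- s`; so `ρ u` is
    -- the conjugate of `u` over `F`.
    norm : ∀ {u} → Fixed σ (proj₁ u) →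
           u E^×.∙ (ρ • u) ∈ NormGroup s
    norm {u} σu≈u =
      u , to ρ (proj₁ u) , fixed⇒Adjoin σu≈u , fixed⇒conjugate σu≈u , refl

  -- The product is `f² - a g²`, an explicit element of `F`. This is how norms from `E₁` and `E₂`
  -- are seen to be fixed by every automorphism.
  conjugate-product : ∀ {s x x̄} a → s * s ≈ ⟦ a ⟧ → Conjugate s x x̄ →
                      ∃[ f ] ⟦ f ⟧ ≈ x * x̄
  conjugate-product {s} {x} {x̄} a s²≈a (f , g , x≈ , x̄≈) =
    f F.* f F.- g F.* g F.* a , sym (begin
      x * x̄                                       ≈⟨ *-cong x≈ x̄≈ ⟩
      (⟦ f ⟧ + ⟦ g ⟧ * s) * (⟦ f ⟧ - ⟦ g ⟧ * s)   ≈⟨ [x+y][x-y]≈x²-y² _ _ ⟩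
      ⟦ f ⟧ * ⟦ f ⟧ - ⟦ g ⟧ * s * (⟦ g ⟧ * s)     ≈⟨ +-congˡ (-‿cong (*.interchange _ _ _ _)) ⟩
      ⟦ f ⟧ * ⟦ f ⟧ - ⟦ g ⟧ * ⟦ g ⟧ * (s * s)     ≈⟨ +-cong (*-homo f f) (-‿cong
                                                     (trans (*-homo _ a) (*-cong (*-homo g g) (sym s²≈a)))) ⟨
      ⟦ f F.* f ⟧ - ⟦ g F.* g F.* a ⟧             ≈⟨ +-congˡ (-‿homo _) ⟨
      ⟦ f F.* f ⟧ + ⟦ F.- (g F.* g F.* a) ⟧       ≈⟨ +-homo _ _ ⟨
      ⟦ f F.* f F.- g F.* g F.* a ⟧               ∎)

  base-fixed : ∀ σ {x} → ∃[ f ] ⟦ f ⟧ ≈ x → Fixed σ x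
  base-fixed σ (f , f≈x) = fixed-resp σ f≈x (A.fixesBase σ f)

  -- The biquadratic extension: its automorphisms and descent to `F`.

  module Biquadratic
    (2#0 : (F.1# F.+ F.1#) F.# F.0#)
    (a₁ a₂ : F^×) (√a₁ √a₂ : Carrier)
    (√a₁² : √a₁ * √a₁ ≈ ⟦ proj₁ a₁ ⟧)
    (√a₂² : √a₂ * √a₂ ≈ ⟦ proj₁ a₂ ⟧)
    (generated : ∀ x → x ∈ Adjoin (｛ √a₁ ｝ ∪ ｛ √a₂ ｝))
    (isGalois : IsGalois)
    (σ₁ σ₂ : Automorphism)
    (σ₁√a₁ : to σ₁ √a₁ ≈ √a₁) (σ₁√a₂ : to σ₁ √a₂ ≈ - √a₂)
    (σ₂√a₂ : to σ₂ √a₂ ≈ √a₂) (σ₂√a₁ : to σ₂ √a₁ ≈ - √a₁)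
    where

    open Subsets √a₁ √a₂ σ₁ σ₂
    open GroupSubsets E^×.group using (gen; unit; mul; inv; resp)

    private
      half : F.Carrier
      half = Units.recip F 2#0

      2*half≈1 : (1# + 1#) * ⟦ half ⟧ ≈ 1#
      2*half≈1 = trans (*-congʳ (sym (trans (+-homo _ _) (+-cong 1#-homo 1#-homo))))
                       (⟦⟧-inverse (Units.recip-inverseʳ F 2#0))

      -- Apartness from zero passes from `F` to `E` through an explicit inverse, since `ι` preserves
      -- the equation `x * y = 1`.
      2#0ᴱ : 1# + 1# # 0#
      2#0ᴱ = rightInverse⇒#0 2*half≈1

      √²-inverse : ∀ (a : F^×) {s} → s * s ≈ ⟦ proj₁ a ⟧ →
                   s * s * ⟦ Units.recip F (proj₂ a) ⟧ ≈ 1#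
      √²-inverse a s²≈a =
        trans (*-congʳ s²≈a) (⟦⟧-inverse (Units.recip-inverseʳ F (proj₂ a)))

      √#0 : ∀ (a : F^×) {s} → s * s ≈ ⟦ proj₁ a ⟧ → s # 0#
      √#0 a s²≈a = rightInverse⇒#0 (trans (sym (*-assoc _ _ _)) (√²-inverse a s²≈a))

      -- The square of `s` lies in `F`, so `τ s` and `s` have the same square; `s + s` is nonzero
      -- because 2 and `s` are.
      √-image : ∀ τ (a : F^×) {s} → s * s ≈ ⟦ proj₁ a ⟧ → to τ s ≈ s ⊎ to τ s ≈ - s
      √-image τ a {s} s²≈a = square-roots s+s#0 (begin
        to τ s * to τ s      ≈⟨ A.*-homo τ s s ⟨
        to τ (s * s)         ≈⟨ A.⟦⟧-cong τ s²≈a ⟩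
        to τ ⟦ proj₁ a ⟧     ≈⟨ A.fixesBase τ _ ⟩
        ⟦ proj₁ a ⟧          ≈⟨ s²≈a ⟨
        s * s                ∎)
        where
        open HeytingProperties heytingCommutativeRing using (#-congʳ)
        s+s#0 : s + s # 0#
        s+s#0 = #-congʳ (trans (distribˡ s 1# 1#) (+-cong (*-identityʳ s) (*-identityʳ s)))
                        (x#0y#0→xy#0 (√#0 a s²≈a) 2#0ᴱ)

    -- Since the two roots generate `E` over `F`, an identity between automorphisms need only be
    -- checked on them. Involutivity and commutation below are obtained in this way.
    agree : ∀ σ τ → to σ √a₁ ≈ to τ √a₁ → to σ √a₂ ≈ to τ √a₂ → ∀ x → to σ x ≈ to τ x
    agree σ τ p q x = agree-on-Adjoin σ τ (λ where
      (inj₁ ≡.refl) → p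
      (inj₂ ≡.refl) → q) (generated x)

    neg-twice : ∀ σ {s} → to σ s ≈ - s → to σ (to σ s) ≈ s
    neg-twice σ {s} p = begin
      to σ (to σ s)   ≈⟨ A.⟦⟧-cong σ p ⟩
      to σ (- s)      ≈⟨ A.-‿homo σ s ⟩
      - to σ s        ≈⟨ -‿cong p ⟩
      - - s           ≈⟨ -‿involutive s ⟩
      s               ∎

    fixed-twice : ∀ σ {s} → Fixed σ s → to σ (to σ s) ≈ s
    fixed-twice σ p = trans (A.⟦⟧-cong σ p) p

    σ₁-involutive : ∀ x → to σ₁ (to σ₁ x) ≈ x
    σ₁-involutive = agree (σ₁ ∘ᴬ σ₁) identity (fixed-twice σ₁ σ₁√a₁) (neg-twice σ₁ σ₁√a₂)

    σ₂-involutive : ∀ x → to σ₂ (to σ₂ x) ≈ x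
    σ₂-involutive = agree (σ₂ ∘ᴬ σ₂) identity (neg-twice σ₂ σ₂√a₁) (fixed-twice σ₂ σ₂√a₂)

    neg-commutes : ∀ σ τ {s} → Fixed σ s → to τ s ≈ - s → to σ (to τ s) ≈ to τ (to σ s)
    neg-commutes σ τ p q = trans (A.⟦⟧-cong σ q)
      (trans (fixed-neg σ p) (sym (trans (A.⟦⟧-cong τ p) q)))

    commute : ∀ x → to σ₁ (to σ₂ x) ≈ to σ₂ (to σ₁ x)
    commute = agree (σ₁ ∘ᴬ σ₂) (σ₂ ∘ᴬ σ₁)
      (neg-commutes σ₁ σ₂ σ₁√a₁ σ₂√a₁) (sym (neg-commutes σ₂ σ₁ σ₂√a₂ σ₁√a₂))

    -- An automorphism sends each √aᵢ to ±√aᵢ, so it is 1, σ₁, σ₂ or σ₁σ₂.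
    fixed⇒all-fixed : ∀ {x} → Fixed σ₁ x → Fixed σ₂ x → ∀ τ → Fixed τ x
    fixed⇒all-fixed {x} σ₁x σ₂x τ = cases (√-image τ a₁ √a₁²) (√-image τ a₂ √a₂²)
      where
      cases : to τ √a₁ ≈ √a₁ ⊎ to τ √a₁ ≈ - √a₁ → to τ √a₂ ≈ √a₂ ⊎ to τ √a₂ ≈ - √a₂ →
              Fixed τ x
      cases (inj₁ p) (inj₁ q) = agree τ identity p q x
      cases (inj₁ p) (inj₂ q) =
        trans (agree τ σ₁ (trans p (sym σ₁√a₁)) (trans q (sym σ₁√a₂)) x) σ₁x
      cases (inj₂ p) (inj₁ q) =
        trans (agree τ σ₂ (trans p (sym σ₂√a₁)) (trans q (sym σ₂√a₂)) x) σ₂x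
      cases (inj₂ p) (inj₂ q) = trans
        (agree τ (σ₁ ∘ᴬ σ₂)
          (trans p (sym (trans (A.⟦⟧-cong σ₁ σ₂√a₁) (fixed-neg σ₁ σ₁√a₁))))
          (trans q (sym (trans (A.⟦⟧-cong σ₁ σ₂√a₂) σ₁√a₂))) x)
        (trans (A.⟦⟧-cong σ₁ σ₂x) σ₁x)

    descent : ∀ {x} → Fixed σ₁ x → Fixed σ₂ x → ∃[ f ] ⟦ f ⟧ ≈ x
    descent {x} σ₁x σ₂x = isGalois x (fixed⇒all-fixed σ₁x σ₂x)

    -- `E₁` is the fixed field of `σ₁`, with `σ₂` acting on it as conjugation; `splitting₂`
    -- exchanges the two roles.
    splitting₁ : QuadraticSplitting √a₁ σ₁ σ₂
    splitting₁ = record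
      { half       = half
      ; s⁻²        = Units.recip F (proj₂ a₁)
      ; 2*half≈1   = 2*half≈1
      ; s²*s⁻²≈1   = √²-inverse a₁ √a₁²
      ; σs≈s       = σ₁√a₁
      ; ρs≈-s      = σ₂√a₁
      ; involutive = σ₂-involutive
      ; commute    = commute
      ; descent    = descent
      }

    splitting₂ : QuadraticSplitting √a₂ σ₂ σ₁
    splitting₂ = record
      { half       = half
      ; s⁻²        = Units.recip F (proj₂ a₂)
      ; 2*half≈1   = 2*half≈1
      ; s²*s⁻²≈1   = √²-inverse a₂ √a₂²
      ; σs≈s       = σ₂√a₂
      ; ρs≈-s      = σ₁√a₂
      ; involutive = σ₁-involutive
      ; commute    = λ x → sym (commute x)
      ; descent    = λ σ₂x σ₁x → descent σ₁x σ₂x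
      }

    -- The inclusions among the five subsets.

    private
      module S₁ = QuadraticSplitting splitting₁
      module S₂ = QuadraticSplitting splitting₂

    K₁⇒K₂ : ∀ {e} → e ∈ K₁ → e ∈ K₂
    K₁⇒K₂ {e , e#0} e∈K₁ =
      k , (y , y#0) , fixed⇒ker σ₁ {k} σ₁k , fixed⇒ker σ₂ {y , y#0} σ₂y , sym zy-e
      where
      e₁ e₂ e₁₂ r w : Carrier
      e₁  = to σ₁ e
      e₂  = to σ₂ e
      e₁₂ = to σ₁ e₂
      r   = Units.recip E (A.to-#0 σ₁ e#0)
      w   = e * r

      e₁r≈1 : e₁ * r ≈ 1#
      e₁r≈1 = Units.recip-inverseʳ E (A.to-#0 σ₁ e#0)

      wσ₁w≈1 : w * to σ₁ w ≈ 1#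
      wσ₁w≈1 = begin
        e * r * to σ₁ (e * r)      ≈⟨ *-congˡ (A.*-homo σ₁ e r) ⟩
        e * r * (e₁ * to σ₁ r)     ≈⟨ *-congˡ (*-comm _ _) ⟩
        e * r * (to σ₁ r * e₁)     ≈⟨ *.interchange _ _ _ _ ⟩
        -- Writing `e` as `σ₁ (σ₁ e)` turns the first pair into the image under `σ₁` of
        -- `e₁ * r = 1`.
        e * to σ₁ r * (r * e₁)     ≈⟨ *-cong (*-congʳ (sym (σ₁-involutive e))) (*-comm r e₁) ⟩
        to σ₁ e₁ * to σ₁ r * (e₁ * r) ≈⟨ *-cong (to-inverse σ₁ e₁r≈1) e₁r≈1 ⟩
        1# * 1#                    ≈⟨ *-identityˡ 1# ⟩
        1#                         ∎

      -- Here `σ₂ r` is the inverse of `σ₂ (σ₁ e) = e₁₂`. With denominators cleared,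
      -- `e₂ / e₁₂ = e / e₁` is exactly the equation defining `K₁`.
      σ₂w : Fixed σ₂ w
      σ₂w = trans (A.*-homo σ₂ e r)
        (fraction-≈ (trans (*-congʳ (commute e)) (to-inverse σ₂ e₁r≈1)) e₁r≈1
          (trans (*-comm e₂ e₁) (sym e∈K₁)))

      -- The root `√a₂` is negated by `σ₁`, as Hilbert 90 requires, and fixed by `σ₂`; together with
      -- `σ₂w` this puts `y` in the fixed field of `σ₂`.
      h90 = hilbert90 σ₁ 2#0ᴱ (√#0 a₂ √a₂²) σ₁√a₂ wσ₁w≈1

      y : Carrier
      y = proj₁ h90

      y#0 : y # 0#
      y#0 = proj₁ (proj₂ h90)

      wσ₁y≈y : w * to σ₁ y ≈ y
      wσ₁y≈y = proj₁ (proj₂ (proj₂ h90))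

      σ₂y : Fixed σ₂ y
      σ₂y = proj₂ (proj₂ (proj₂ h90)) σ₂ σ₂√a₂ σ₂w

      z : Carrier
      z = Units.recip E y#0

      yz≈1 : y * z ≈ 1#
      yz≈1 = Units.recip-inverseʳ E y#0

      k : E^×
      k = e * z , x#0y#0→xy#0 e#0 (rightInverse⇒#0 (Units.recip-inverseˡ E y#0))

      zy-e : e * z * y ≈ e
      zy-e = trans (*-assoc _ _ _) (trans (*-congˡ (Units.recip-inverseˡ E y#0)) (*-identityʳ e))

      -- This is `e / σ₁ e = y / σ₁ y` without denominators; it shows that `e / y` is fixed by `σ₁`.
      e₁y≈eσ₁y : e₁ * y ≈ e * to σ₁ y
      e₁y≈eσ₁y = begin
        e₁ * y                     ≈⟨ *-congˡ wσ₁y≈y ⟨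
        e₁ * (e * r * to σ₁ y)     ≈⟨ *-congˡ (*.xy∙z≈y∙xz e r _) ⟩
        e₁ * (r * (e * to σ₁ y))   ≈⟨ *-assoc _ _ _ ⟨
        e₁ * r * (e * to σ₁ y)     ≈⟨ *-congʳ e₁r≈1 ⟩
        1# * (e * to σ₁ y)         ≈⟨ *-identityˡ _ ⟩
        e * to σ₁ y                ∎

      σ₁k : Fixed σ₁ (e * z)
      σ₁k = trans (A.*-homo σ₁ e z) (fraction-≈ (to-inverse σ₁ yz≈1) yz≈1 e₁y≈eσ₁y)

    -- Because `σ₁` and `σ₂` commute, their product acts as `σ₂` on elements fixed by `σ₁` and as
    -- `σ₁` on elements fixed by `σ₂`.
    norm-factors : ∀ {e u v} → Fixed σ₁ u → Fixed σ₂ v → e ≈ u * v →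
                   e * to σ₁ (to σ₂ e) ≈ u * to σ₂ u * (v * to σ₁ v)
    norm-factors {e} {u} {v} σ₁u σ₂v e≈uv = begin
      e * to σ₁ (to σ₂ e)                           ≈⟨ *-cong e≈uv (trans
                                                         (A.⟦⟧-cong σ₁ (trans (A.⟦⟧-cong σ₂ e≈uv) (A.*-homo σ₂ u v)))
                                                         (A.*-homo σ₁ _ _)) ⟩
      u * v * (to σ₁ (to σ₂ u) * to σ₁ (to σ₂ v))   ≈⟨ *-congˡ (*-cong
                                                         (trans (commute u) (A.⟦⟧-cong σ₂ σ₁u)) (A.⟦⟧-cong σ₁ σ₂v)) ⟩
      u * v * (to σ₂ u * to σ₁ v)                   ≈⟨ *.interchange _ _ _ _ ⟩
      u * to σ₂ u * (v * to σ₁ v)                   ∎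

    -- As `σ₁` is an involution, it sends `e * σ₁ (σ₂ e)` to `σ₁ e * σ₂ e`, so the two sides of the
    -- `K₁` equation are the norm and its image under `σ₁`.
    σ₁-fixes-norm⇒K₁ : ∀ {e} → Fixed σ₁ (proj₁ (N[E/E₃] e)) → e ∈ K₁
    σ₁-fixes-norm⇒K₁ {e , _} p =
      trans (sym p) (trans (A.*-homo σ₁ _ _) (*-congˡ (σ₁-involutive (to σ₂ e))))

    K₁⇒σ₁-fixes-norm : ∀ {e} → e ∈ K₁ → Fixed σ₁ (proj₁ (N[E/E₃] e))
    K₁⇒σ₁-fixes-norm {e , _} e∈K₁ =
      trans (A.*-homo σ₁ _ _) (trans (*-congˡ (σ₁-involutive (to σ₂ e))) (sym e∈K₁))

    K₁⇒σ₂-fixes-norm : ∀ {e} → e ∈ K₁ → Fixed σ₂ (proj₁ (N[E/E₃] e))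
    K₁⇒σ₂-fixes-norm {e , _} e∈K₁ = begin
      to σ₂ (e * to σ₁ (to σ₂ e))           ≈⟨ A.*-homo σ₂ _ _ ⟩
      to σ₂ e * to σ₂ (to σ₁ (to σ₂ e))     ≈⟨ *-congˡ (trans (sym (commute _)) (A.⟦⟧-cong σ₁ (σ₂-involutive e))) ⟩
      to σ₂ e * to σ₁ e                     ≈⟨ *-comm _ _ ⟩
      to σ₁ e * to σ₂ e                     ≈⟨ e∈K₁ ⟨
      e * to σ₁ (to σ₂ e)                   ∎

    -- For `e = u v` one has `σ₁ e = u * σ₁ v` and `σ₂ e = σ₂ u * v`; their product is a
    -- rearrangement of the factored norm.
    K₂⇒K₁ : ∀ {e} → e ∈ K₂ → e ∈ K₁
    K₂⇒K₁ {e , _} (u , v , u∈ker , v∈ker , e≈uv) = begin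
      e * to σ₁ (to σ₂ e)                                     ≈⟨ norm-factors σ₁u σ₂v e≈uv ⟩
      proj₁ u * to σ₂ (proj₁ u) * (proj₁ v * to σ₁ (proj₁ v)) ≈⟨ *-congˡ (*-comm _ _) ⟩
      proj₁ u * to σ₂ (proj₁ u) * (to σ₁ (proj₁ v) * proj₁ v) ≈⟨ *.interchange _ _ _ _ ⟩
      proj₁ u * to σ₁ (proj₁ v) * (to σ₂ (proj₁ u) * proj₁ v) ≈⟨ *-cong
        (trans (A.⟦⟧-cong σ₁ e≈uv) (trans (A.*-homo σ₁ _ _) (*-congʳ σ₁u)))
        (trans (A.⟦⟧-cong σ₂ e≈uv) (trans (A.*-homo σ₂ _ _) (*-congˡ σ₂v))) ⟨
      to σ₁ e * to σ₂ e                                       ∎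
      where
      σ₁u = ker⇒fixed σ₁ {u} u∈ker
      σ₂v = ker⇒fixed σ₂ {v} v∈ker

    K₂⇒K₃ : ∀ {e} → e ∈ K₂ → e ∈ K₃
    K₂⇒K₃ (u , v , u∈ker , v∈ker , e≈uv) = resp (sym e≈uv)
      (mul {x = u} {v} (gen (inj₁ (S₁.fixed⇒Adjoin (ker⇒fixed σ₁ {u} u∈ker))))
                       (gen (inj₂ (S₂.fixed⇒Adjoin (ker⇒fixed σ₂ {v} v∈ker)))))

    -- `K₁` is the kernel of an endomorphism of the unit group, hence a subgroup, and it contains
    -- every unit fixed by `σ₁` or by `σ₂`. The induction follows the generation of `K₃`.
    K₃⇒K₁ : ∀ {e} → e ∈ K₃ → e ∈ K₁
    K₃⇒K₁ (gen {x , _} (inj₁ x∈E₁)) =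
      *-cong (sym σ₁x) (trans (commute x) (A.⟦⟧-cong σ₂ σ₁x))
      where σ₁x = Adjoin-fixed σ₁ σ₁√a₁ x∈E₁
    K₃⇒K₁ (gen {x , _} (inj₂ x∈E₂)) =
      trans (*-cong (sym σ₂x) (A.⟦⟧-cong σ₁ σ₂x)) (*-comm _ _)
      where σ₂x = Adjoin-fixed σ₂ σ₂√a₂ x∈E₂
    K₃⇒K₁ unit =
      *-cong (sym (A.1#-homo σ₁)) (trans (A.⟦⟧-cong σ₁ (A.1#-homo σ₂))
        (trans (A.1#-homo σ₁) (sym (A.1#-homo σ₂))))
    K₃⇒K₁ (mul {x , _} {y , _} x∈K₃ y∈K₃) = begin
      x * y * to σ₁ (to σ₂ (x * y))
        ≈⟨ *-congˡ (A.*-homo (σ₁ ∘ᴬ σ₂) x y) ⟩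
      x * y * (to σ₁ (to σ₂ x) * to σ₁ (to σ₂ y))
        ≈⟨ *.interchange _ _ _ _ ⟩
      x * to σ₁ (to σ₂ x) * (y * to σ₁ (to σ₂ y))
        ≈⟨ *-cong (K₃⇒K₁ x∈K₃) (K₃⇒K₁ y∈K₃) ⟩
      to σ₁ x * to σ₂ x * (to σ₁ y * to σ₂ y)
        ≈⟨ *.interchange _ _ _ _ ⟩
      to σ₁ x * to σ₁ y * (to σ₂ x * to σ₂ y)
        ≈⟨ *-cong (A.*-homo σ₁ x y) (A.*-homo σ₂ x y) ⟨
      to σ₁ (x * y) * to σ₂ (x * y)
        ∎
    -- Both sides of the equation for the inverse of `x` are inverse to `x * σ₁ (σ₂ x)`.
    K₃⇒K₁ (inv {x , x#0} x∈K₃) = inverse-unique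
      (product-inverse xx′≈1 (to-inverse (σ₁ ∘ᴬ σ₂) xx′≈1))
      (trans (*-congʳ (K₃⇒K₁ x∈K₃))
        (product-inverse (to-inverse σ₁ xx′≈1) (to-inverse σ₂ xx′≈1)))
      where
      xx′≈1 : x * Units.recip E x#0 ≈ 1#
      xx′≈1 = Units.recip-inverseʳ E x#0
      product-inverse : ∀ {p p′ q q′} → p * p′ ≈ 1# → q * q′ ≈ 1# → p * q * (p′ * q′) ≈ 1#
      product-inverse pp′ qq′ =
        trans (*.interchange _ _ _ _) (trans (*-cong pp′ qq′) (*-identityˡ 1#))
    K₃⇒K₁ (resp {x , _} {y , _} x≈y x∈K₃) = begin
      y * to σ₁ (to σ₂ y)   ≈⟨ *-cong x≈y (A.⟦⟧-cong (σ₁ ∘ᴬ σ₂) x≈y) ⟨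
      x * to σ₁ (to σ₂ x)   ≈⟨ K₃⇒K₁ x∈K₃ ⟩
      to σ₁ x * to σ₂ x     ≈⟨ *-cong (A.⟦⟧-cong σ₁ x≈y) (A.⟦⟧-cong σ₂ x≈y) ⟩
      to σ₁ y * to σ₂ y     ∎

    K₁⇒K₄ : ∀ {e} → e ∈ K₁ → e ∈ K₄
    K₁⇒K₄ {e} e∈K₁ = (f , Units.rightInverse⇒#0 F (⟦⟧-reflects-inverse ff′≈1)) , f≈n
      where
      n#0 = proj₂ (N[E/E₃] e)
      nn′≈1 = Units.recip-inverseʳ E n#0
      σ₁n = K₁⇒σ₁-fixes-norm {e} e∈K₁
      σ₂n = K₁⇒σ₂-fixes-norm {e} e∈K₁
      n-descends = descent σ₁n σ₂n
      -- `K₄` asks for a unit of `F`, so the inverse of the norm is descended as well. The two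
      -- descents multiply to 1 in `E`, hence already in `F`.
      n′-descends = descent (fixed-inverse σ₁ nn′≈1 σ₁n) (fixed-inverse σ₂ nn′≈1 σ₂n)
      f = proj₁ n-descends
      f≈n = proj₂ n-descends
      ff′≈1 : ⟦ f ⟧ * ⟦ proj₁ n′-descends ⟧ ≈ 1#
      ff′≈1 = trans (*-cong f≈n (proj₂ n′-descends)) nn′≈1

    K₄⇒K₁ : ∀ {e} → e ∈ K₄ → e ∈ K₁
    K₄⇒K₁ {e} ((f , _) , f≈n) = σ₁-fixes-norm⇒K₁ {e} (base-fixed σ₁ (f , f≈n))

    K₂⇒K₅ : ∀ {e} → e ∈ K₂ → e ∈ K₅
    K₂⇒K₅ (u , v , u∈ker , v∈ker , e≈uv) =
      u E^×.∙ (σ₂ • u) , v E^×.∙ (σ₁ • v) , S₁.norm {u} σ₁u , S₂.norm {v} σ₂v ,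
      norm-factors σ₁u σ₂v e≈uv
      where
      σ₁u = ker⇒fixed σ₁ {u} u∈ker
      σ₂v = ker⇒fixed σ₂ {v} v∈ker

    -- Each norm factor comes from `F` by `conjugate-product`, so `σ₁` fixes their product, which is
    -- the norm of `e` to `E₃`.
    K₅⇒K₁ : ∀ {e} → e ∈ K₅ → e ∈ K₁
    K₅⇒K₁ {e} (_ , _ , (_ , _ , _ , conj₁ , n₁≈) , (_ , _ , _ , conj₂ , n₂≈) , n≈n₁n₂) =
      σ₁-fixes-norm⇒K₁ {e} (fixed-resp σ₁ (sym n≈n₁n₂) (fixed-* σ₁
        (fixed-resp σ₁ (sym n₁≈) (base-fixed σ₁ (conjugate-product (proj₁ a₁) √a₁² conj₁)))
        (fixed-resp σ₁ (sym n₂≈) (base-fixed σ₁ (conjugate-product (proj₁ a₂) √a₂² conj₂)))))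

    -- The inclusions used form the cycles `K₁ ⊆ K₂ ⊆ K₃ ⊆ K₁`, `K₁ ⊆ K₂ ⊆ K₅ ⊆ K₁` and
    -- `K₁ ⊆ K₄ ⊆ K₁`; the remaining ones are composites.
    K₁≐K₂≐K₃≐K₄≐K₅ : (K₁ ≐ K₂) × (K₂ ≐ K₃) × (K₃ ≐ K₄) × (K₄ ≐ K₅)
    K₁≐K₂≐K₃≐K₄≐K₅ =
        ((λ {e} → K₁⇒K₂ {e}) , (λ {e} → K₂⇒K₁ {e}))
      , (K₂⇒K₃ , (λ {e} p → K₁⇒K₂ {e} (K₃⇒K₁ p)))
      , ((λ {e} p → K₁⇒K₄ {e} (K₃⇒K₁ p)) , (λ {e} p → K₂⇒K₃ (K₁⇒K₂ {e} (K₄⇒K₁ {e} p))))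
      , ((λ {e} p → K₂⇒K₅ {e} (K₁⇒K₂ {e} (K₄⇒K₁ {e} p))) , (λ {e} p → K₁⇒K₄ {e} (K₅⇒K₁ {e} p)))

theorem4 :
  ∀ {c ℓ₁ ℓ₂ c′ ℓ₁′ ℓ₂′ : Level}
    (F : HeytingField c ℓ₁ ℓ₂) (E : HeytingField c′ ℓ₁′ ℓ₂′)
    (ι : RingHomomorphism (rawRing F) (rawRing E)) →
  let module F = HeytingField F
      module E = HeytingField E
      open RingHomomorphism ι using (⟦_⟧)
      open Extension F E ι
      open Automorphism using (to)
  in
  (F.1# F.+ F.1#) F.# F.0# →
  (a₁ a₂ : F^×) (√a₁ √a₂ : E.Carrier) →
  √a₁ E.* √a₁ E.≈ ⟦ proj₁ a₁ ⟧ →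
  √a₂ E.* √a₂ E.≈ ⟦ proj₁ a₂ ⟧ →
  (∀ x → x ∈ Adjoin (｛ √a₁ ｝ ∪ ｛ √a₂ ｝)) →
  IsGalois →
  Gal ≅ ℤ/2×ℤ/2 →
  (σ₁ σ₂ : Automorphism) →
  to σ₁ √a₁ E.≈ √a₁ → to σ₁ √a₂ E.≈ E.- √a₂ →
  to σ₂ √a₂ E.≈ √a₂ → to σ₂ √a₁ E.≈ E.- √a₁ →
  let open Subsets √a₁ √a₂ σ₁ σ₂
  in (K₁ ≐ K₂) × (K₂ ≐ K₃) × (K₃ ≐ K₄) × (K₄ ≐ K₅)
theorem4 F E ι 2#0 a₁ a₂ √a₁ √a₂ √a₁² √a₂² generated isGalois _ =
  AutomorphismProperties.Biquadratic.K₁≐K₂≐K₃≐K₄≐K₅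
    F E ι 2#0 a₁ a₂ √a₁ √a₂ √a₁² √a₂² generated isGalois
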